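{- Let $n>1$ and let $L_1,\dots,L_n$ be finitely presented linear orders with $\mathrm{wd}(L_i)=1$ for $1\le i\le n$ and $\mathrm{wd}(L_i+L_{i+1})=2$ for $1\le i<n$. Then $\mathrm{wd}(L_1+L_2+\dots+L_n)=n$.
   Context: $A\times B:=\sum_{a\in A}B$ (lexicographic product, first coordinate dominant); $\omega^*$ is the reverse of $\omega$, $\omega^+:=\omega$, $\omega^-:=\omega^*$, $\omega^0:=\mathbf 1$. Finitely presented linear orders: the smallest class of linear orders closed under isomorphism, containing $\mathbf 0,\mathbf 1$, closed under finite sums and under $L\mapsto\omega\times L$, $L\mapsto\omega^*\times L$. 3-signed trees: a tree is a nonempty finite $T\subseteq\omega^{<\omega}$ closed under initial segments, root $\emptyset$, standard labelling ($\sigma*x\in T$ iff $x<w(T;\sigma)$, where $w(T;\sigma)$ is the number of children of $\sigma$). A 3ST is $(T,s_T)$ with $s_T:T\to\{+,-,0\}$, $s_T(\sigma)=0$ iff $\sigma$ is root or leaf. $\mathrm{LIN}(T,s_T):=\mathbf 0$ if $|T|=1$; otherwise $\mathrm{LIN}(T,s_T,\sigma):=\omega^{s_T(\sigma)}\times\sum_{x<w(T;\sigma)}\mathrm{LIN}(T,s_T,\sigma*x)$ (empty sum $=\mathbf 1$) and $\mathrm{LIN}(T,s_T):=\mathrm{LIN}(T,s_T,\emptyset)$. The width $\mathrm{wd}(L)$ of a finitely presented $L$ is the minimum of $w(T;\emptyset)$ over all 3STs with $\mathrm{LIN}(T,s_T)\cong L$. -}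

module Defs where

open import Level using (0ℓ)
open import Data.Empty using (⊥)
open import Data.Unit using (⊤; tt)
open import Data.Nat as ℕ using (ℕ; zero; suc; _≤_)
import Data.Nat.Properties as ℕP
open import Data.Fin using (Fin; zero; suc)
open import Data.Sum using (_⊎_; inj₁; inj₂)
open import Data.Product using (Σ; _×_; _,_; ∃)
open import Data.List using (List; []; _∷_; length)
open import Data.List.Relation.Unary.All using (All)
open import Relation.Nullary using (¬_)
open import Relation.Binary.Core using (Rel)
open import Relation.Binary.Definitions using (Trichotomous; Tri; tri<; tri≈; tri>; Irreflexive; Transitive)
open import Relation.Binary.Structures using (IsStrictTotalOrder; IsStrictPartialOrder)
open import Relation.Binary.PropositionalEquality using (_≡_; refl; isEquivalence; subst; resp₂; cong; cong₂; sym)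

record LinOrd : Set₁ where
  field
    Carrier : Set
    _<_     : Rel Carrier 0ℓ
    isSTO   : IsStrictTotalOrder _≡_ _<_

open LinOrd public using (Carrier; isSTO) renaming (_<_ to lt)

mkSTO : {A : Set} {_<_ : Rel A 0ℓ} → Irreflexive _≡_ _<_ → Transitive _<_ →
        Trichotomous _≡_ _<_ → IsStrictTotalOrder _≡_ _<_
mkSTO {_<_ = _<_} irr tr cmp = record
  { isStrictPartialOrder = record
      { isEquivalence = isEquivalence
      ; irrefl = irr
      ; trans = tr
      ; <-resp-≈ = resp₂ _<_ }
  ; compare = cmp }

𝟘 : LinOrd
𝟘 = record { Carrier = ⊥ ; _<_ = λ _ _ → ⊥ ; isSTO = mkSTO (λ _ ()) (λ ()) (λ ()) }

𝟙 : LinOrd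
𝟙 = record { Carrier = ⊤ ; _<_ = λ _ _ → ⊥ ; isSTO = mkSTO (λ _ ()) (λ ())
  (λ { tt tt → tri≈ (λ ()) refl (λ ()) }) }

ω : LinOrd
ω = record { Carrier = ℕ ; _<_ = ℕ._<_ ; isSTO = ℕP.<-isStrictTotalOrder }

ω* : LinOrd
ω* = record { Carrier = ℕ ; _<_ = λ m n → n ℕ.< m
            ; isSTO = mkSTO (λ { refl p → ℕP.<-irrefl refl p })
                            (λ p q → ℕP.<-trans q p) cmp }
  where
  cmp : Trichotomous _≡_ (λ m n → n ℕ.< m)
  cmp m n with ℕP.<-cmp m n
  ... | tri< a b c = tri> c b a
  ... | tri≈ a b c = tri≈ c b a
  ... | tri> a b c = tri< c b a

module _ (L M : LinOrd) where
  private
    module L = IsStrictTotalOrder (isSTO L)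
    module M = IsStrictTotalOrder (isSTO M)
    _<L_ = lt L
    _<M_ = lt M

  data SumLt : Rel (Carrier L ⊎ Carrier M) 0ℓ where
    ₁<₁ : ∀ {a a'} → a <L a' → SumLt (inj₁ a) (inj₁ a')
    ₂<₂ : ∀ {b b'} → b <M b' → SumLt (inj₂ b) (inj₂ b')
    ₁<₂ : ∀ {a b} → SumLt (inj₁ a) (inj₂ b)

  private
    irrS : Irreflexive _≡_ SumLt
    irrS refl (₁<₁ p) = L.irrefl refl p
    irrS refl (₂<₂ p) = M.irrefl refl p

    trS : Transitive SumLt
    trS (₁<₁ p) (₁<₁ q) = ₁<₁ (L.trans p q)
    trS (₁<₁ p) ₁<₂ = ₁<₂
    trS (₂<₂ p) (₂<₂ q) = ₂<₂ (M.trans p q)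
    trS ₁<₂ (₂<₂ q) = ₁<₂

    cmpS : Trichotomous _≡_ SumLt
    cmpS (inj₁ a) (inj₁ a') with L.compare a a'
    ... | tri< x y z = tri< (₁<₁ x) (λ { refl → y refl }) (λ { (₁<₁ w) → z w })
    ... | tri≈ x refl z = tri≈ (λ { (₁<₁ w) → x w }) refl (λ { (₁<₁ w) → z w })
    ... | tri> x y z = tri> (λ { (₁<₁ w) → x w }) (λ { refl → y refl }) (₁<₁ z)
    cmpS (inj₁ a) (inj₂ b) = tri< ₁<₂ (λ ()) (λ ())
    cmpS (inj₂ b) (inj₁ a) = tri> (λ ()) (λ ()) ₁<₂
    cmpS (inj₂ b) (inj₂ b') with M.compare b b'
    ... | tri< x y z = tri< (₂<₂ x) (λ { refl → y refl }) (λ { (₂<₂ w) → z w })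
    ... | tri≈ x refl z = tri≈ (λ { (₂<₂ w) → x w }) refl (λ { (₂<₂ w) → z w })
    ... | tri> x y z = tri> (λ { (₂<₂ w) → x w }) (λ { refl → y refl }) (₂<₂ z)

  infixl 6 _⊕_
  _⊕_ : LinOrd
  _⊕_ = record { Carrier = Carrier L ⊎ Carrier M ; _<_ = SumLt
               ; isSTO = mkSTO irrS trS cmpS }

module _ (L M : LinOrd) where
  private
    module L = IsStrictTotalOrder (isSTO L)
    module M = IsStrictTotalOrder (isSTO M)
    _<L_ = lt L
    _<M_ = lt M

  data LexLt : Rel (Carrier L × Carrier M) 0ℓ where
    fst< : ∀ {a a' b b'} → a <L a' → LexLt (a , b) (a' , b')
    snd< : ∀ {a b b'} → b <M b' → LexLt (a , b) (a , b')

  private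
    irrX : Irreflexive _≡_ LexLt
    irrX refl (fst< p) = L.irrefl refl p
    irrX refl (snd< p) = M.irrefl refl p

    trX : Transitive LexLt
    trX (fst< p) (fst< q) = fst< (L.trans p q)
    trX (fst< p) (snd< q) = fst< p
    trX (snd< p) (fst< q) = fst< q
    trX (snd< p) (snd< q) = snd< (M.trans p q)

    cmpX : Trichotomous _≡_ LexLt
    cmpX (a , b) (a' , b') with L.compare a a'
    ... | tri< x y z = tri< (fst< x) (λ { refl → y refl })
            (λ { (fst< w) → z w ; (snd< w) → y refl })
    ... | tri> x y z = tri> (λ { (fst< w) → x w ; (snd< w) → y refl })
            (λ { refl → y refl }) (fst< z)
    ... | tri≈ x refl z with M.compare b b'
    ...   | tri< u v t = tri< (snd< u) (λ { refl → v refl })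
              (λ { (fst< w) → z w ; (snd< w) → t w })
    ...   | tri≈ u refl t = tri≈ (λ { (fst< w) → x w ; (snd< w) → u w }) refl
              (λ { (fst< w) → z w ; (snd< w) → t w })
    ...   | tri> u v t = tri> (λ { (fst< w) → x w ; (snd< w) → u w })
              (λ { refl → v refl }) (snd< t)

  infixl 7 _⊗_
  _⊗_ : LinOrd
  _⊗_ = record { Carrier = Carrier L × Carrier M ; _<_ = LexLt
               ; isSTO = mkSTO irrX trX cmpX }

record _≅_ (L M : LinOrd) : Set where
  field
    to       : Carrier L → Carrier M
    from     : Carrier M → Carrier L
    from∘to  : ∀ x → from (to x) ≡ x
    to∘from  : ∀ y → to (from y) ≡ y
    to-mono  : ∀ {x y} → lt L x y → lt M (to x) (to y)
    to-refl  : ∀ {x y} → lt M (to x) (to y) → lt L x y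

data FinPres : LinOrd → Set₁ where
  fp𝟘   : FinPres 𝟘
  fp𝟙   : FinPres 𝟙
  fp⊕   : ∀ {L M} → FinPres L → FinPres M → FinPres (L ⊕ M)
  fpω   : ∀ {L} → FinPres L → FinPres (ω ⊗ L)
  fpω*  : ∀ {L} → FinPres L → FinPres (ω* ⊗ L)
  fp≅   : ∀ {L M} → L ≅ M → FinPres L → FinPres M

⨁ : (n : ℕ) → (Fin n → LinOrd) → LinOrd
⨁ zero    L = 𝟘
⨁ (suc n) L = L zero ⊕ ⨁ n (λ i → L (suc i))

-- 3-signed trees.  A finite tree T ⊆ ω^{<ω} with standard labelling is
-- the same thing as a finite ordered (rose) tree: the children of σ are
-- σ*0, …, σ*(w(T;σ)-1), listed in that order.

data Sign : Set where
  plus minus nul : Sign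

data SignedTree : Set where
  node : Sign → List SignedTree → SignedTree

data NonRootOK : SignedTree → Set where
  leaf  : NonRootOK (node nul [])
  inner : ∀ {s c cs} → (s ≡ plus ⊎ s ≡ minus) →
          All NonRootOK (c ∷ cs) → NonRootOK (node s (c ∷ cs))

Is3ST : SignedTree → Set
Is3ST (node s cs) = s ≡ nul × All NonRootOK cs

rootWidth : SignedTree → ℕ
rootWidth (node _ cs) = length cs

ωPow : Sign → LinOrd
ωPow plus  = ω
ωPow minus = ω*
ωPow nul   = 𝟙

mutual
  linAt : SignedTree → LinOrd
  linAt (node s [])       = ωPow s ⊗ 𝟙          -- empty sum = 1
  linAt (node s (c ∷ cs)) = ωPow s ⊗ linSum c cs

  linSum : SignedTree → List SignedTree → LinOrd
  linSum c []        = linAt c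
  linSum c (d ∷ ds)  = linAt c ⊕ linSum d ds

LIN : SignedTree → LinOrd
LIN (node s [])       = 𝟘
LIN (node s (c ∷ cs)) = linAt (node s (c ∷ cs))

HasWidth : LinOrd → ℕ → Set
HasWidth L k =
  (Σ SignedTree λ T → Is3ST T × (LIN T ≅ L) × rootWidth T ≡ k) ×
  (∀ T → Is3ST T → LIN T ≅ L → k ≤ rootWidth T)

{-# OPTIONS --safe #-}
module Submission where

-- Width one means being 𝟙, ω ⊗ K or ω* ⊗ K, so the claim is that a sum of n such blocks L i, no two
-- neighbours of which merge into one block, is never a sum of fewer than n blocks P j. Let each L i choose the
-- P j in which it becomes cofinal (for ω ⊗ K) or coinitial (for ω* ⊗ K). If two of them choose the same P j,
-- then some pair of neighbours merges: either its sum is a segment of one P j, or glue-ω or its mirror image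
-- applies; the remaining overlaps would make some ω ⊗ M isomorphic to an ω* ⊗ N, contradicting scatteredness.
-- The lower bound is a stable statement, so excluded middle may be used for it under double negation.

open import Defs renaming (_≅_ to infix 4 _≅_)
open import Data.Nat using (ℕ; suc; _<_)
open import Data.Fin using (Fin; toℕ)
open import Relation.Binary.PropositionalEquality using (_≡_)

open import Level using (0ℓ) renaming (suc to lsuc)
open import Data.Bool using (Bool; true; false; T)
open import Data.Bool.Properties using (T-irrelevant)
open import Data.Empty using (⊥; ⊥-elim)
open import Data.Unit using (tt)
open import Data.Nat using (zero; _+_; _*_; _∸_; _≤_; _<?_; _≤?_; z≤n; s≤s)
import Data.Nat.Properties as ℕₚ
open import Data.Nat.DivMod using (_divMod_; module DivMod)
open import Data.Fin using (zero; suc; fromℕ<)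
import Data.Fin.Properties as Finₚ
open import Data.List using (List; []; _∷_; _++_; length; map; tabulate)
open import Data.List.Properties using (length-tabulate; length-map)
open import Data.List.Relation.Unary.All using (All; []; _∷_)
open import Data.List.Relation.Unary.All.Properties using (++⁺; tabulate⁺)
open import Data.List.Relation.Unary.Linked using (Linked; []; [-]; _∷_)
open import Data.Product using (Σ; Σ-syntax; _×_; _,_; proj₁; proj₂)
open import Data.Sum using (_⊎_; inj₁; inj₂)
open import Data.Sum.Properties using (inj₁-injective; inj₂-injective)
open import Function using (_∘_; id)
open import Relation.Binary.Bundles using (Setoid)
open import Relation.Binary.Definitions using (tri<; tri≈; tri>)
open import Relation.Binary.PropositionalEquality using (refl; sym; trans; cong; cong₂; subst; subst₂)
open import Relation.Binary.Structures using (IsStrictTotalOrder)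
open import Relation.Nullary using (¬_; yes; no)
open import Relation.Nullary.Decidable using (decidable-stable; ¬¬-excluded-middle)
import Relation.Binary.Reasoning.Setoid as SetoidReasoning

open _≅_

-- Isomorphisms of linear orders

module _ (L M : LinOrd) where
  private
    module L = IsStrictTotalOrder (isSTO L)
    module M = IsStrictTotalOrder (isSTO M)

  -- Between linear orders, trichotomy makes a strictly monotone map reflect the order and be
  -- injective, so the second inverse law follows from the first.
  iso : (f : Carrier L → Carrier M) (g : Carrier M → Carrier L) → (∀ y → f (g y) ≡ y) →
        (∀ {x y} → lt L x y → lt M (f x) (f y)) → L ≅ M
  iso f g fg mono = record
    { to = f ; from = g ; from∘to = gf ; to∘from = fg ; to-mono = mono ; to-refl = reflects }
    where
    reflects : ∀ {x y} → lt M (f x) (f y) → lt L x y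
    reflects {x} {y} p with L.compare x y
    ... | tri< q _ _ = q
    ... | tri≈ _ refl _ = ⊥-elim (M.irrefl refl p)
    ... | tri> _ _ q = ⊥-elim (M.asym p (mono q))
    gf : ∀ x → g (f x) ≡ x
    gf x with L.compare (g (f x)) x
    ... | tri< q _ _ = ⊥-elim (M.irrefl (fg (f x)) (mono q))
    ... | tri≈ _ e _ = e
    ... | tri> _ _ q = ⊥-elim (M.irrefl (sym (fg (f x))) (mono q))

≅-refl : ∀ {L} → L ≅ L
≅-refl {L} = iso L L id id (λ _ → refl) id

≅-sym : ∀ {L M} → L ≅ M → M ≅ L
≅-sym {L} {M} f = record
  { to = from f ; from = to f ; from∘to = to∘from f ; to∘from = from∘to f
  ; to-mono = λ {x} {y} p → to-refl f (subst₂ (lt M) (sym (to∘from f x)) (sym (to∘from f y)) p)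
  ; to-refl = λ {x} {y} p → subst₂ (lt M) (to∘from f x) (to∘from f y) (to-mono f p) }

≅-trans : ∀ {L M N} → L ≅ M → M ≅ N → L ≅ N
≅-trans {L} {M} {N} f g = iso L N (to g ∘ to f) (from f ∘ from g)
  (λ y → trans (cong (to g) (to∘from f _)) (to∘from g y)) (to-mono g ∘ to-mono f)

≅-setoid : Setoid (lsuc 0ℓ) 0ℓ
≅-setoid = record
  { Carrier = LinOrd ; _≈_ = _≅_
  ; isEquivalence = record { refl = ≅-refl ; sym = ≅-sym ; trans = ≅-trans } }

open SetoidReasoning ≅-setoid

empty≅𝟘 : ∀ {L} → ¬ Carrier L → L ≅ 𝟘
empty≅𝟘 {L} e = iso L 𝟘 e ⊥-elim (λ ()) (λ {x} _ → ⊥-elim (e x))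

⊕-cong : ∀ {A B C D} → A ≅ C → B ≅ D → A ⊕ B ≅ C ⊕ D
⊕-cong {A} {B} {C} {D} f g = iso (A ⊕ B) (C ⊕ D) F G FG mono
  where
  F : Carrier (A ⊕ B) → Carrier (C ⊕ D)
  F (inj₁ x) = inj₁ (to f x)
  F (inj₂ x) = inj₂ (to g x)
  G : Carrier (C ⊕ D) → Carrier (A ⊕ B)
  G (inj₁ x) = inj₁ (from f x)
  G (inj₂ x) = inj₂ (from g x)
  FG : ∀ y → F (G y) ≡ y
  FG (inj₁ x) = cong inj₁ (to∘from f x)
  FG (inj₂ x) = cong inj₂ (to∘from g x)
  mono : ∀ {x y} → lt (A ⊕ B) x y → lt (C ⊕ D) (F x) (F y)
  mono (₁<₁ p) = ₁<₁ (to-mono f p)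
  mono (₂<₂ p) = ₂<₂ (to-mono g p)
  mono ₁<₂ = ₁<₂

⊕-congˡ : ∀ {A B D} → B ≅ D → A ⊕ B ≅ A ⊕ D
⊕-congˡ = ⊕-cong ≅-refl

⊕-congʳ : ∀ {A B C} → A ≅ C → A ⊕ B ≅ C ⊕ B
⊕-congʳ f = ⊕-cong f ≅-refl

⊕-assoc : ∀ A B C → A ⊕ B ⊕ C ≅ A ⊕ (B ⊕ C)
⊕-assoc A B C = iso (A ⊕ B ⊕ C) (A ⊕ (B ⊕ C)) F G FG mono
  where
  F : Carrier (A ⊕ B ⊕ C) → Carrier (A ⊕ (B ⊕ C))
  F (inj₁ (inj₁ x)) = inj₁ x
  F (inj₁ (inj₂ x)) = inj₂ (inj₁ x)
  F (inj₂ x) = inj₂ (inj₂ x)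
  G : Carrier (A ⊕ (B ⊕ C)) → Carrier (A ⊕ B ⊕ C)
  G (inj₁ x) = inj₁ (inj₁ x)
  G (inj₂ (inj₁ x)) = inj₁ (inj₂ x)
  G (inj₂ (inj₂ x)) = inj₂ x
  FG : ∀ y → F (G y) ≡ y
  FG (inj₁ x) = refl
  FG (inj₂ (inj₁ x)) = refl
  FG (inj₂ (inj₂ x)) = refl
  mono : ∀ {x y} → lt (A ⊕ B ⊕ C) x y → lt (A ⊕ (B ⊕ C)) (F x) (F y)
  mono (₁<₁ (₁<₁ p)) = ₁<₁ p
  mono (₁<₁ (₂<₂ p)) = ₂<₂ (₁<₁ p)
  mono (₁<₁ ₁<₂) = ₁<₂
  mono (₂<₂ p) = ₂<₂ (₂<₂ p)
  mono {inj₁ (inj₁ _)} ₁<₂ = ₁<₂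
  mono {inj₁ (inj₂ _)} ₁<₂ = ₂<₂ ₁<₂

⊕-emptyʳ : ∀ {A B} → ¬ Carrier B → A ⊕ B ≅ A
⊕-emptyʳ {A} {B} e = ≅-sym (iso A (A ⊕ B) inj₁ G GF ₁<₁)
  where
  G : Carrier (A ⊕ B) → Carrier A
  G (inj₁ x) = x
  G (inj₂ x) = ⊥-elim (e x)
  GF : ∀ y → inj₁ (G y) ≡ y
  GF (inj₁ x) = refl
  GF (inj₂ x) = ⊥-elim (e x)

⊕-emptyˡ : ∀ {A B} → ¬ Carrier A → A ⊕ B ≅ B
⊕-emptyˡ {A} {B} e = ≅-sym (iso B (A ⊕ B) inj₂ G GF ₂<₂)
  where
  G : Carrier (A ⊕ B) → Carrier B
  G (inj₁ x) = ⊥-elim (e x)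
  G (inj₂ x) = x
  GF : ∀ y → inj₂ (G y) ≡ y
  GF (inj₁ x) = ⊥-elim (e x)
  GF (inj₂ x) = refl

⊗-cong : ∀ {A B C D} → A ≅ C → B ≅ D → A ⊗ B ≅ C ⊗ D
⊗-cong {A} {B} {C} {D} f g = iso (A ⊗ B) (C ⊗ D)
  (λ (a , b) → to f a , to g b) (λ (c , d) → from f c , from g d)
  (λ (c , d) → cong₂ _,_ (to∘from f c) (to∘from g d))
  (λ { (fst< p) → fst< (to-mono f p) ; (snd< p) → snd< (to-mono g p) })

⊗-congˡ : ∀ {A B D} → B ≅ D → A ⊗ B ≅ A ⊗ D
⊗-congˡ = ⊗-cong ≅-refl

⊗-assoc : ∀ A B C → A ⊗ B ⊗ C ≅ A ⊗ (B ⊗ C)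
⊗-assoc A B C = iso (A ⊗ B ⊗ C) (A ⊗ (B ⊗ C))
  (λ ((a , b) , c) → a , (b , c)) (λ (a , (b , c)) → (a , b) , c) (λ _ → refl)
  (λ { (fst< (fst< p)) → fst< p ; (fst< (snd< p)) → snd< (fst< p) ; (snd< p) → snd< (snd< p) })

𝟙⊗ : ∀ A → 𝟙 ⊗ A ≅ A
𝟙⊗ A = iso (𝟙 ⊗ A) A proj₂ (tt ,_) (λ _ → refl) (λ { (snd< p) → p })

-- Reversal

op : LinOrd → LinOrd
op L = record
  { Carrier = Carrier L ; _<_ = λ x y → lt L y x
  ; isSTO = mkSTO (λ { refl p → S.irrefl refl p }) (λ p q → S.trans q p) cmp }
  where
  module S = IsStrictTotalOrder (isSTO L)
  cmp : ∀ x y → _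
  cmp x y with S.compare x y
  ... | tri< a b c = tri> c b a
  ... | tri≈ a b c = tri≈ c b a
  ... | tri> a b c = tri< c b a

op-cong : ∀ {L M} → L ≅ M → op L ≅ op M
op-cong {L} {M} f = iso (op L) (op M) (to f) (from f) (to∘from f) (to-mono f)

op-op : ∀ L → op (op L) ≅ L
op-op L = iso (op (op L)) L id id (λ _ → refl) id

op-⊕ : ∀ A B → op (A ⊕ B) ≅ op B ⊕ op A
op-⊕ A B = iso (op (A ⊕ B)) (op B ⊕ op A) F G FG mono
  where
  F : Carrier (A ⊕ B) → Carrier (B ⊕ A)
  F (inj₁ x) = inj₂ x
  F (inj₂ x) = inj₁ x
  G : Carrier (B ⊕ A) → Carrier (A ⊕ B)
  G (inj₁ x) = inj₂ x
  G (inj₂ x) = inj₁ x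
  FG : ∀ y → F (G y) ≡ y
  FG (inj₁ x) = refl
  FG (inj₂ x) = refl
  mono : ∀ {x y} → lt (A ⊕ B) y x → lt (op B ⊕ op A) (F x) (F y)
  mono (₁<₁ p) = ₂<₂ p
  mono (₂<₂ p) = ₁<₁ p
  mono ₁<₂ = ₁<₂

op-ω⊗ : ∀ M → op (ω ⊗ M) ≅ ω* ⊗ op M
op-ω⊗ M = iso (op (ω ⊗ M)) (ω* ⊗ op M) id id (λ _ → refl)
  (λ { (fst< p) → fst< p ; (snd< p) → snd< p })

op-ω*⊗ : ∀ M → op (ω* ⊗ M) ≅ ω ⊗ op M
op-ω*⊗ M = iso (op (ω* ⊗ M)) (ω ⊗ op M) id id (λ _ → refl)
  (λ { (fst< p) → fst< p ; (snd< p) → snd< p })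

-- Multiples

𝐅 : ℕ → LinOrd
𝐅 n = record { Carrier = Fin n ; _<_ = Data.Fin._<_ ; isSTO = Finₚ.<-isStrictTotalOrder }

𝐅-suc : ∀ n M → 𝐅 (suc n) ⊗ M ≅ M ⊕ 𝐅 n ⊗ M
𝐅-suc n M = ≅-sym (iso (M ⊕ 𝐅 n ⊗ M) (𝐅 (suc n) ⊗ M) F G FG mono)
  where
  F : Carrier (M ⊕ 𝐅 n ⊗ M) → Carrier (𝐅 (suc n) ⊗ M)
  F (inj₁ m) = zero , m
  F (inj₂ (i , m)) = suc i , m
  G : Carrier (𝐅 (suc n) ⊗ M) → Carrier (M ⊕ 𝐅 n ⊗ M)
  G (zero , m) = inj₁ m
  G (suc i , m) = inj₂ (i , m)
  FG : ∀ y → F (G y) ≡ y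
  FG (zero , m) = refl
  FG (suc i , m) = refl
  mono : ∀ {x y} → lt (M ⊕ 𝐅 n ⊗ M) x y → lt (𝐅 (suc n) ⊗ M) (F x) (F y)
  mono (₁<₁ p) = snd< p
  mono (₂<₂ (fst< p)) = fst< (s≤s p)
  mono (₂<₂ (snd< p)) = snd< p
  mono ₁<₂ = fst< (s≤s z≤n)

ω⊗𝐅 : ∀ n → ω ⊗ 𝐅 (suc n) ≅ ω
ω⊗𝐅 n = iso (ω ⊗ 𝐅 (suc n)) ω
  (λ (q , r) → toℕ r + q * suc n)
  (λ k → DivMod.quotient (k divMod suc n) , DivMod.remainder (k divMod suc n))
  (λ k → sym (DivMod.property (k divMod suc n)))
  mono
  where
  mono : ∀ {x y} → lt (ω ⊗ 𝐅 (suc n)) x y →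
         toℕ (proj₂ x) + proj₁ x * suc n < toℕ (proj₂ y) + proj₁ y * suc n
  mono {q , r} {q' , r'} (fst< p) = ℕₚ.<-≤-trans
    (ℕₚ.+-monoˡ-< (q * suc n) (Finₚ.toℕ<n r))
    (ℕₚ.≤-trans (ℕₚ.*-monoˡ-≤ (suc n) p) (ℕₚ.m≤n+m (q' * suc n) (toℕ r')))
  mono {q , r} (snd< p) = ℕₚ.+-monoˡ-< (q * suc n) p

-- Groups the copies of `M` into packets of `suc n`; with packets of size zero this would fail.
ω⊗-multiple : ∀ n M → ω ⊗ (𝐅 (suc n) ⊗ M) ≅ ω ⊗ M
ω⊗-multiple n M = ≅-trans (≅-sym (⊗-assoc ω (𝐅 (suc n)) M)) (⊗-cong (ω⊗𝐅 n) ≅-refl)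

multiple⊕ω⊗ : ∀ n M → 𝐅 n ⊗ M ⊕ ω ⊗ M ≅ ω ⊗ M
multiple⊕ω⊗ n M = iso (𝐅 n ⊗ M ⊕ ω ⊗ M) (ω ⊗ M) F G FG mono
  where
  F : Carrier (𝐅 n ⊗ M ⊕ ω ⊗ M) → Carrier (ω ⊗ M)
  F (inj₁ (i , m)) = toℕ i , m
  F (inj₂ (k , m)) = n + k , m
  G : Carrier (ω ⊗ M) → Carrier (𝐅 n ⊗ M ⊕ ω ⊗ M)
  G (k , m) with k <? n
  ... | yes p = inj₁ (fromℕ< p , m)
  ... | no _ = inj₂ (k ∸ n , m)
  FG : ∀ y → F (G y) ≡ y
  FG (k , m) with k <? n
  ... | yes p = cong (_, m) (Finₚ.toℕ-fromℕ< p)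
  ... | no ¬p = cong (_, m) (ℕₚ.m+[n∸m]≡n (ℕₚ.≮⇒≥ ¬p))
  mono : ∀ {x y} → lt (𝐅 n ⊗ M ⊕ ω ⊗ M) x y → lt (ω ⊗ M) (F x) (F y)
  mono (₁<₁ (fst< p)) = fst< p
  mono (₁<₁ (snd< p)) = snd< p
  mono (₂<₂ (fst< p)) = fst< (ℕₚ.+-monoʳ-< n p)
  mono (₂<₂ (snd< p)) = snd< p
  mono {inj₁ (i , _)} {inj₂ (k , _)} ₁<₂ = fst< (ℕₚ.<-≤-trans (Finₚ.toℕ<n i) (ℕₚ.m≤m+n n k))

unroll : ∀ M → ω ⊗ M ≅ M ⊕ ω ⊗ M
unroll M = iso (ω ⊗ M) (M ⊕ ω ⊗ M) F G FG mono
  where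
  F : Carrier (ω ⊗ M) → Carrier (M ⊕ ω ⊗ M)
  F (zero , m) = inj₁ m
  F (suc k , m) = inj₂ (k , m)
  G : Carrier (M ⊕ ω ⊗ M) → Carrier (ω ⊗ M)
  G (inj₁ m) = zero , m
  G (inj₂ (k , m)) = suc k , m
  FG : ∀ y → F (G y) ≡ y
  FG (inj₁ m) = refl
  FG (inj₂ (k , m)) = refl
  mono : ∀ {x y} → lt (ω ⊗ M) x y → lt (M ⊕ ω ⊗ M) (F x) (F y)
  mono {zero , _} {suc _ , _} (fst< p) = ₁<₂
  mono {suc _ , _} {suc _ , _} (fst< (s≤s p)) = ₂<₂ (fst< p)
  mono {zero , _} (snd< p) = ₁<₁ p
  mono {suc _ , _} (snd< p) = ₂<₂ (snd< p)

-- Both sides read X + Y + X + Y + ...; only the brackets move by one place.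
rotate : ∀ X Y → X ⊕ ω ⊗ (Y ⊕ X) ≅ ω ⊗ (X ⊕ Y)
rotate X Y = ≅-sym (iso (ω ⊗ (X ⊕ Y)) (X ⊕ ω ⊗ (Y ⊕ X)) F G FG mono)
  where
  F : Carrier (ω ⊗ (X ⊕ Y)) → Carrier (X ⊕ ω ⊗ (Y ⊕ X))
  F (zero , inj₁ x) = inj₁ x
  F (suc k , inj₁ x) = inj₂ (k , inj₂ x)
  F (k , inj₂ y) = inj₂ (k , inj₁ y)
  G : Carrier (X ⊕ ω ⊗ (Y ⊕ X)) → Carrier (ω ⊗ (X ⊕ Y))
  G (inj₁ x) = zero , inj₁ x
  G (inj₂ (k , inj₁ y)) = k , inj₂ y
  G (inj₂ (k , inj₂ x)) = suc k , inj₁ x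
  FG : ∀ z → F (G z) ≡ z
  FG (inj₁ x) = refl
  FG (inj₂ (zero , inj₁ y)) = refl
  FG (inj₂ (suc k , inj₁ y)) = refl
  FG (inj₂ (k , inj₂ x)) = refl
  mono : ∀ {x y} → lt (ω ⊗ (X ⊕ Y)) x y → lt (X ⊕ ω ⊗ (Y ⊕ X)) (F x) (F y)
  mono {zero , inj₁ _} {suc _ , inj₁ _} (fst< p) = ₁<₂
  mono {zero , inj₁ _} {suc _ , inj₂ _} (fst< p) = ₁<₂
  mono {zero , inj₂ _} {suc zero , inj₁ _} (fst< p) = ₂<₂ (snd< ₁<₂)
  mono {zero , inj₂ _} {suc (suc _) , inj₁ _} (fst< p) = ₂<₂ (fst< (s≤s z≤n))
  mono {zero , inj₂ _} {suc _ , inj₂ _} (fst< p) = ₂<₂ (fst< p)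
  mono {suc _ , inj₁ _} {suc _ , inj₁ _} (fst< (s≤s p)) = ₂<₂ (fst< p)
  mono {suc _ , inj₁ _} {suc _ , inj₂ _} (fst< p) = ₂<₂ (fst< (ℕₚ.<-trans (ℕₚ.n<1+n _) p))
  -- If `suc i` equals `j`, both points land in the same copy of `Y ⊕ X`, where `Y` comes first.
  mono {suc i , inj₂ _} {suc j , inj₁ _} (fst< (s≤s p)) with ℕₚ.m≤n⇒m<n∨m≡n p
  ... | inj₁ q = ₂<₂ (fst< q)
  ... | inj₂ refl = ₂<₂ (snd< ₁<₂)
  mono {suc _ , inj₂ _} {suc _ , inj₂ _} (fst< p) = ₂<₂ (fst< p)
  mono {zero , inj₁ _} (snd< (₁<₁ p)) = ₁<₁ p
  mono {suc _ , inj₁ _} (snd< (₁<₁ p)) = ₂<₂ (snd< (₂<₂ p))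
  mono {zero , _} (snd< (₂<₂ p)) = ₂<₂ (snd< (₁<₁ p))
  mono {suc _ , _} (snd< (₂<₂ p)) = ₂<₂ (snd< (₁<₁ p))
  mono {zero , _} (snd< ₁<₂) = ₁<₂
  mono {suc _ , _} (snd< ₁<₂) = ₂<₂ (fst< (ℕₚ.n<1+n _))

-- Refining two decompositions of the same order

isRight : ∀ {A B : Set} → A ⊎ B → Bool
isRight (inj₁ _) = false
isRight (inj₂ _) = true

fromLeft : ∀ {A B : Set} (s : A ⊎ B) → (∀ b → ¬ s ≡ inj₂ b) → Σ[ a ∈ A ] s ≡ inj₁ a
fromLeft (inj₁ a) _ = a , refl
fromLeft (inj₂ b) h = ⊥-elim (h b refl)

fromRight : ∀ {A B : Set} (s : A ⊎ B) → (∀ a → ¬ s ≡ inj₁ a) → Σ[ b ∈ B ] s ≡ inj₂ b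
fromRight (inj₁ a) h = ⊥-elim (h a refl)
fromRight (inj₂ b) _ = b , refl

₁<₁⁻¹ : ∀ {A B x y} → lt (A ⊕ B) (inj₁ x) (inj₁ y) → lt A x y
₁<₁⁻¹ (₁<₁ p) = p

₂<₂⁻¹ : ∀ {A B x y} → lt (A ⊕ B) (inj₂ x) (inj₂ y) → lt B x y
₂<₂⁻¹ (₂<₂ p) = p

-- The predicate is `Bool`-valued so that membership proofs are unique; otherwise points with the
-- same first component could fail to be equal, and trichotomy would break.
restrict : (L : LinOrd) → (Carrier L → Bool) → LinOrd
restrict L P = record
  { Carrier = Σ[ x ∈ Carrier L ] T (P x) ; _<_ = λ x y → lt L (proj₁ x) (proj₁ y)
  ; isSTO = mkSTO (λ { refl p → S.irrefl refl p }) S.trans cmp }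
  where
  module S = IsStrictTotalOrder (isSTO L)
  cmp : ∀ x y → _
  cmp (x , p) (y , q) with S.compare x y
  ... | tri< a b c = tri< a (b ∘ cong proj₁) c
  ... | tri≈ a refl c = tri≈ a (cong (x ,_) (T-irrelevant p q)) c
  ... | tri> a b c = tri> a (b ∘ cong proj₁) c

-- When `B` and `C` do not meet, `C` is an initial segment of `A` and `B` a final segment of `D`.
-- What is left over in `A` and in `D` is the same piece `A∩D`.
module Overlap {A B C D : LinOrd} (f : A ⊕ B ≅ C ⊕ D)
               (B∩C : ∀ b c → ¬ to f (inj₂ b) ≡ inj₁ c) where

  A∩D : LinOrd
  A∩D = restrict A (λ a → isRight (to f (inj₁ a)))

  point : ∀ a d → to f (inj₁ a) ≡ inj₂ d → Carrier A∩D
  point a d e = a , subst (T ∘ isRight) (sym e) tt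

  private
    to-right : (x : Carrier A∩D) → Σ[ d ∈ Carrier D ] to f (inj₁ (proj₁ x)) ≡ inj₂ d
    to-right (a , p) with to f (inj₁ a)
    ... | inj₂ d = d , refl

    C→A : ∀ c → Σ[ a ∈ Carrier A ] from f (inj₁ c) ≡ inj₁ a
    C→A c = fromLeft (from f (inj₁ c)) (λ b e →
      B∩C b c (trans (cong (to f) (sym e)) (to∘from f (inj₁ c))))

    B→D : ∀ b → Σ[ d ∈ Carrier D ] to f (inj₂ b) ≡ inj₂ d
    B→D b = fromRight (to f (inj₂ b)) (B∩C b)

    F₁ : Carrier (C ⊕ A∩D) → Carrier A
    F₁ (inj₁ c) = proj₁ (C→A c)
    F₁ (inj₂ (a , _)) = a

    incl₁ : Carrier (C ⊕ A∩D) → Carrier (C ⊕ D)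
    incl₁ (inj₁ c) = inj₁ c
    incl₁ (inj₂ x) = inj₂ (proj₁ (to-right x))

    to-F₁ : ∀ z → to f (inj₁ (F₁ z)) ≡ incl₁ z
    to-F₁ (inj₁ c) = trans (cong (to f) (sym (proj₂ (C→A c)))) (to∘from f (inj₁ c))
    to-F₁ (inj₂ x) = proj₂ (to-right x)

    incl₁-mono : ∀ {x y} → lt (C ⊕ A∩D) x y → lt (C ⊕ D) (incl₁ x) (incl₁ y)
    incl₁-mono (₁<₁ p) = ₁<₁ p
    incl₁-mono {inj₂ x} {inj₂ y} (₂<₂ p) =
      subst₂ (lt (C ⊕ D)) (to-F₁ (inj₂ x)) (to-F₁ (inj₂ y)) (to-mono f (₁<₁ p))
    incl₁-mono ₁<₂ = ₁<₂

    F₁-mono : ∀ {x y} → lt (C ⊕ A∩D) x y → lt A (F₁ x) (F₁ y)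
    F₁-mono {x} {y} p = ₁<₁⁻¹ (to-refl f
      (subst₂ (lt (C ⊕ D)) (sym (to-F₁ x)) (sym (to-F₁ y)) (incl₁-mono p)))

    G₁ : ∀ a → Σ[ z ∈ Carrier (C ⊕ A∩D) ] F₁ z ≡ a
    G₁ a with to f (inj₁ a) in e
    ... | inj₂ d = inj₂ (point a d e) , refl
    ... | inj₁ c = inj₁ c , inj₁-injective
      (trans (sym (proj₂ (C→A c))) (trans (cong (from f) (sym e)) (from∘to f (inj₁ a))))

    F₂ : Carrier (A∩D ⊕ B) → Carrier D
    F₂ (inj₁ x) = proj₁ (to-right x)
    F₂ (inj₂ b) = proj₁ (B→D b)

    incl₂ : Carrier (A∩D ⊕ B) → Carrier (A ⊕ B)
    incl₂ (inj₁ (a , _)) = inj₁ a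
    incl₂ (inj₂ b) = inj₂ b

    to-incl₂ : ∀ z → to f (incl₂ z) ≡ inj₂ (F₂ z)
    to-incl₂ (inj₁ x) = proj₂ (to-right x)
    to-incl₂ (inj₂ b) = proj₂ (B→D b)

    incl₂-mono : ∀ {x y} → lt (A∩D ⊕ B) x y → lt (A ⊕ B) (incl₂ x) (incl₂ y)
    incl₂-mono (₁<₁ p) = ₁<₁ p
    incl₂-mono (₂<₂ p) = ₂<₂ p
    incl₂-mono ₁<₂ = ₁<₂

    G₂ : ∀ d → Σ[ z ∈ Carrier (A∩D ⊕ B) ] F₂ z ≡ d
    G₂ d with from f (inj₂ d) in e
    ... | inj₁ a = inj₁ (point a d to-a) , inj₂-injective (trans (sym (to-incl₂ (inj₁ (point a d to-a)))) to-a)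
      where
      to-a : to f (inj₁ a) ≡ inj₂ d
      to-a = trans (cong (to f) (sym e)) (to∘from f (inj₂ d))
    ... | inj₂ b = inj₂ b , inj₂-injective (trans (sym (proj₂ (B→D b)))
                                      (trans (cong (to f) (sym e)) (to∘from f (inj₂ d))))

  left : A ≅ C ⊕ A∩D
  left = ≅-sym (iso (C ⊕ A∩D) A F₁ (proj₁ ∘ G₁) (proj₂ ∘ G₁) F₁-mono)

  right : A∩D ⊕ B ≅ D
  right = iso (A∩D ⊕ B) D F₂ (proj₁ ∘ G₂) (proj₂ ∘ G₂) (λ {x} {y} p →
    ₂<₂⁻¹ (subst₂ (lt (C ⊕ D)) (to-incl₂ x) (to-incl₂ y) (to-mono f (incl₂-mono p))))

data Refinement (A B C D : LinOrd) : Set₁ where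
  aligned : A ≅ C → B ≅ D → Refinement A B C D
  longer  : ∀ X → Carrier X → A ≅ C ⊕ X → X ⊕ B ≅ D → Refinement A B C D
  shorter : ∀ X → Carrier X → A ⊕ X ≅ C → B ≅ X ⊕ D → Refinement A B C D

-- Of two cuts of one linear order, one comes first or they coincide. Which case holds is
-- undecidable, hence the double negation. If `A` and `D` do not meet, `Overlap` applies to the
-- inverse isomorphism.
refine : ∀ {A B C D} → A ⊕ B ≅ C ⊕ D → ¬ ¬ Refinement A B C D
refine {A} {B} {C} {D} f k = ¬¬-excluded-middle {A = Meets} λ
  { (yes (a , d , e)) →
      let module O = Overlap f (λ b c e' → ₂≮₁ (subst₂ (lt (C ⊕ D)) e e' (to-mono f ₁<₂)))
      in k (longer O.A∩D (O.point a d e) O.left O.right)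
  ; (no ¬A∩D) →
      let module O = Overlap (≅-sym f) (λ d a e →
                       ¬A∩D (a , d , trans (cong (to f) (sym e)) (to∘from f (inj₂ d))))
      in ¬¬-excluded-middle {A = Carrier O.A∩D} λ
        { (yes x) → k (shorter O.A∩D x (≅-sym O.left) (≅-sym O.right))
        ; (no ¬x) → k (aligned (≅-sym (≅-trans O.left (⊕-emptyʳ ¬x)))
                               (≅-trans (≅-sym O.right) (⊕-emptyˡ ¬x))) } }
  where
  Meets : Set
  Meets = Σ[ a ∈ Carrier A ] Σ[ d ∈ Carrier D ] to f (inj₁ a) ≡ inj₂ d
  ₂≮₁ : ∀ {c d} → ¬ lt (C ⊕ D) (inj₂ d) (inj₁ c)
  ₂≮₁ ()

lex-≤ : ∀ {M x y} → lt (ω ⊗ M) x y → proj₁ x ≤ proj₁ y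
lex-≤ (fst< p) = ℕₚ.<⇒≤ p
lex-≤ (snd< _) = ℕₚ.≤-refl

record BoundedCut (M A B : LinOrd) : Set₁ where
  field
    bound : ℕ
    rest  : LinOrd
    below : 𝐅 (suc bound) ⊗ M ≅ A ⊕ rest
    above : rest ⊕ ω ⊗ M ≅ B

-- If `b` lies in the copy of `M` with index `n`, all of `A` lies below `b`, hence within the first
-- `suc n` copies. `Overlap` then splits these copies into `A` and a remainder belonging to `B`.
bounded-cut : ∀ {M A B} → ω ⊗ M ≅ A ⊕ B → Carrier B → BoundedCut M A B
bounded-cut {M} {A} {B} f b = record { bound = n ; rest = O.A∩D ; below = O.left ; above = O.right }
  where
  n = proj₁ (from f (inj₂ b))
  far : ∀ {k m} → ¬ lt (ω ⊗ M) (suc n + k , m) (from f (inj₂ b))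
  far {k} p = ℕₚ.<⇒≱ (s≤s (ℕₚ.m≤m+n n k)) (lex-≤ p)
  module O = Overlap (≅-trans (multiple⊕ω⊗ (suc n) M) f) (λ (k , m) a e →
    far {k} {m} (to-refl f (subst₂ (lt (A ⊕ B)) (sym e) (sym (to∘from f (inj₂ b))) ₁<₂)))

-- Segments of ω ⊗ M and ω* ⊗ M

-- `B` is the remainder followed by ω packets `A ⊕ rest`, and shifting the brackets makes it ω
-- packets `rest ⊕ A`.
final-ω : ∀ {M A B} → ω ⊗ M ≅ A ⊕ B → Carrier B → Σ[ K ∈ LinOrd ] B ≅ ω ⊗ K
final-ω {M} {A} {B} f b = rest ⊕ A , (begin
  B                            ≈⟨ above ⟨
  rest ⊕ ω ⊗ M                 ≈⟨ ⊕-congˡ (ω⊗-multiple bound M) ⟨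
  rest ⊕ ω ⊗ (𝐅 (suc bound) ⊗ M) ≈⟨ ⊕-congˡ (⊗-congˡ below) ⟩
  rest ⊕ ω ⊗ (A ⊕ rest)        ≈⟨ rotate rest A ⟩
  ω ⊗ (rest ⊕ A)               ∎)
  where open BoundedCut (bounded-cut f b)

-- One `V` is split off to join the leading `A`. Every later `V` brings its own `A ⊕ V`, preceded by
-- a `Z` that closes the previous packet.
absorb : ∀ {Z A V} → V ≅ Z ⊕ (A ⊕ V) → A ⊕ ω ⊗ V ≅ ω ⊗ (A ⊕ V ⊕ Z)
absorb {Z} {A} {V} f = begin
  A ⊕ ω ⊗ V                 ≈⟨ ⊕-congˡ (unroll V) ⟩
  A ⊕ (V ⊕ ω ⊗ V)           ≈⟨ ⊕-assoc A V (ω ⊗ V) ⟨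
  A ⊕ V ⊕ ω ⊗ V             ≈⟨ ⊕-congˡ (⊗-congˡ f) ⟩
  A ⊕ V ⊕ ω ⊗ (Z ⊕ (A ⊕ V)) ≈⟨ rotate (A ⊕ V) Z ⟩
  ω ⊗ (A ⊕ V ⊕ Z)           ∎

-- B contains a copy of A ⊕ B, and a finite multiple of M has the form V = B ⊕ X; hence V ≅ Z ⊕ (A ⊕ V).
glue-ω : ∀ {N M A B C} → ω ⊗ N ≅ A ⊕ B → ω ⊗ M ≅ B ⊕ C → Carrier B → Carrier C →
         Σ[ K ∈ LinOrd ] A ⊕ B ⊕ C ≅ ω ⊗ K
glue-ω {N} {M} {A} {B} {C} f g b c = A ⊕ V ⊕ Z , (begin
  A ⊕ B ⊕ C             ≈⟨ ⊕-assoc A B C ⟩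
  A ⊕ (B ⊕ C)           ≈⟨ ⊕-congˡ g ⟨
  A ⊕ ω ⊗ M             ≈⟨ ⊕-congˡ (ω⊗-multiple Q.bound M) ⟨
  A ⊕ ω ⊗ (𝐅 (suc Q.bound) ⊗ M) ≈⟨ ⊕-congˡ (⊗-congˡ Q.below) ⟩
  A ⊕ ω ⊗ V             ≈⟨ absorb V-absorbs-A ⟩
  ω ⊗ (A ⊕ V ⊕ Z)       ∎)
  where
  module P = BoundedCut (bounded-cut f b)
  module Q = BoundedCut (bounded-cut g c)
  Z = P.rest
  X = Q.rest
  V = B ⊕ X
  -- Past the bound of the cut, `B` ends in a full copy of `ω ⊗ N`, which is `A ⊕ B` again.
  B-absorbs-A : B ≅ Z ⊕ (A ⊕ B)
  B-absorbs-A = ≅-trans (≅-sym P.above) (⊕-congˡ f)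
  V-absorbs-A : V ≅ Z ⊕ (A ⊕ V)
  V-absorbs-A = begin
    B ⊕ X             ≈⟨ ⊕-congʳ B-absorbs-A ⟩
    Z ⊕ (A ⊕ B) ⊕ X   ≈⟨ ⊕-assoc Z (A ⊕ B) X ⟩
    Z ⊕ (A ⊕ B ⊕ X)   ≈⟨ ⊕-congˡ (⊕-assoc A B X) ⟩
    Z ⊕ (A ⊕ (B ⊕ X)) ∎

op-≅ω : ∀ {L K} → op L ≅ ω ⊗ K → L ≅ ω* ⊗ op K
op-≅ω {L} {K} f = ≅-trans (≅-sym (op-op L)) (≅-trans (op-cong f) (op-ω⊗ K))

op-ω*≅ : ∀ {M A B} → ω* ⊗ M ≅ A ⊕ B → ω ⊗ op M ≅ op B ⊕ op A
op-ω*≅ {M} {A} {B} f = ≅-trans (≅-sym (op-ω*⊗ M)) (≅-trans (op-cong f) (op-⊕ A B))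

initial-ω* : ∀ {M A B} → ω* ⊗ M ≅ A ⊕ B → Carrier A → Σ[ K ∈ LinOrd ] A ≅ ω* ⊗ K
initial-ω* {B = B} f a =
  let K , e = final-ω {A = op B} (op-ω*≅ f) a in op K , op-≅ω e

-- Reversal exchanges the outer segments, so the points asked for lie in `A` and `B` instead of `B`
-- and `C`.
glue-ω* : ∀ {N M A B C} → ω* ⊗ N ≅ A ⊕ B → ω* ⊗ M ≅ B ⊕ C → Carrier A → Carrier B →
          Σ[ K ∈ LinOrd ] A ⊕ B ⊕ C ≅ ω* ⊗ K
glue-ω* {A = A} {B} {C} f g a b =
  let K , e = glue-ω {A = op C} {op B} {op A} (op-ω*≅ g) (op-ω*≅ f) b a
  in op K , op-≅ω (begin
    op (A ⊕ B ⊕ C)          ≈⟨ op-⊕ (A ⊕ B) C ⟩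
    op C ⊕ op (A ⊕ B)       ≈⟨ ⊕-congˡ (op-⊕ A B) ⟩
    op C ⊕ (op B ⊕ op A)    ≈⟨ ⊕-assoc (op C) (op B) (op A) ⟨
    op C ⊕ op B ⊕ op A      ≈⟨ e ⟩
    ω ⊗ K                   ∎)

-- Segments of finitely presented orders

HasFinPresCuts : LinOrd → Set₁
HasFinPresCuts L = ∀ {A B} → L ≅ A ⊕ B → ¬ ¬ (FinPres A × FinPres B)

fp-empty : ∀ {L} → ¬ Carrier L → FinPres L
fp-empty e = fp≅ (≅-sym (empty≅𝟘 e)) fp𝟘

fp-op : ∀ {L} → FinPres L → FinPres (op L)
fp-op fp𝟘 = fp-empty id
fp-op fp𝟙 = fp≅ (iso 𝟙 (op 𝟙) id id (λ _ → refl) (λ ())) fp𝟙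
fp-op (fp⊕ {L} {M} p q) = fp≅ (≅-sym (op-⊕ L M)) (fp⊕ (fp-op q) (fp-op p))
fp-op (fpω {L} p) = fp≅ (≅-sym (op-ω⊗ L)) (fpω* (fp-op p))
fp-op (fpω* {L} p) = fp≅ (≅-sym (op-ω*⊗ L)) (fpω (fp-op p))
fp-op (fp≅ f p) = fp≅ (op-cong f) (fp-op p)

fp-𝐅⊗ : ∀ n {L} → FinPres L → FinPres (𝐅 n ⊗ L)
fp-𝐅⊗ zero p = fp-empty (λ ())
fp-𝐅⊗ (suc n) {L} p = fp≅ (≅-sym (𝐅-suc n L)) (fp⊕ p (fp-𝐅⊗ n p))

cuts-≅ : ∀ {L M} → L ≅ M → HasFinPresCuts L → HasFinPresCuts M
cuts-≅ f c g = c (≅-trans f g)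

cuts-empty : ∀ {L} → ¬ Carrier L → HasFinPresCuts L
cuts-empty e f k = k (fp-empty (e ∘ from f ∘ inj₁) , fp-empty (e ∘ from f ∘ inj₂))

cuts-𝟙 : HasFinPresCuts 𝟙
cuts-𝟙 {A} {B} f k with to f tt in e
... | inj₁ a = k (fp≅ (≅-trans f (⊕-emptyʳ ¬B)) fp𝟙 , fp-empty ¬B)
  where
  ¬B : ¬ Carrier B
  ¬B b with () ← trans (sym e) (to∘from f (inj₂ b))
... | inj₂ b = k (fp-empty ¬A , fp≅ (≅-trans f (⊕-emptyˡ ¬A)) fp𝟙)
  where
  ¬A : ¬ Carrier A
  ¬A a with () ← trans (sym e) (to∘from f (inj₁ a))

-- The given cut is compared with the seam between `L` and `M`, and falls into one of the two
-- summands or on the seam.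
cuts-⊕ : ∀ {L M} → FinPres L → FinPres M →
         HasFinPresCuts L → HasFinPresCuts M → HasFinPresCuts (L ⊕ M)
cuts-⊕ p q c d f k = refine f λ
  { (aligned g h) → k (fp≅ g p , fp≅ h q)
  ; (longer X _ g h) → c g λ (a , x) → k (a , fp≅ h (fp⊕ x q))
  ; (shorter X _ g h) → d h λ (x , b) → k (fp≅ g (fp⊕ p x) , b) }

cuts-op : ∀ {L} → HasFinPresCuts L → HasFinPresCuts (op L)
cuts-op {L} c {A} {B} f k =
  c (≅-trans (≅-sym (op-op L)) (≅-trans (op-cong f) (op-⊕ A B))) λ (b , a) →
    k (fp≅ (op-op A) (fp-op a) , fp≅ (op-op B) (fp-op b))

cuts-𝐅⊗ : ∀ n {L} → FinPres L → HasFinPresCuts L → HasFinPresCuts (𝐅 n ⊗ L)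
cuts-𝐅⊗ zero p c = cuts-empty (λ ())
cuts-𝐅⊗ (suc n) {L} p c =
  cuts-≅ (≅-sym (𝐅-suc n L)) (cuts-⊕ p (fp-𝐅⊗ n p) c (cuts-𝐅⊗ n p c))

-- If `B` has a point, the cut falls inside a finite multiple of `L`, and `B` is a segment of that
-- multiple followed by `ω ⊗ L`.
cuts-ω⊗ : ∀ {L} → FinPres L → HasFinPresCuts L → HasFinPresCuts (ω ⊗ L)
cuts-ω⊗ {L} p c {A} {B} f k = ¬¬-excluded-middle {A = Carrier B} λ
  { (yes b) →
      let open BoundedCut (bounded-cut f b)
      in cuts-𝐅⊗ (suc bound) p c below λ (a , x) → k (a , fp≅ above (fp⊕ x (fpω p)))
  ; (no ¬b) → k (fp≅ (≅-trans f (⊕-emptyʳ ¬b)) (fpω p) , fp-empty ¬b) }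

fp-cuts : ∀ {L} → FinPres L → HasFinPresCuts L
fp-cuts fp𝟘 = cuts-empty id
fp-cuts fp𝟙 = cuts-𝟙
fp-cuts (fp⊕ p q) = cuts-⊕ p q (fp-cuts p) (fp-cuts q)
fp-cuts (fpω p) = cuts-ω⊗ p (fp-cuts p)
fp-cuts (fpω* {L} p) =
  cuts-≅ (≅-trans (op-ω⊗ (op L)) (⊗-congˡ (op-op L))) (cuts-op (cuts-ω⊗ (fp-op p) (cuts-op (fp-cuts p))))
fp-cuts (fp≅ f p) = cuts-≅ f (fp-cuts p)

-- `K` is the first copy in `ω ⊗ K`, hence an initial segment of `L`.
fp-factor-ω : ∀ {L K} → FinPres L → L ≅ ω ⊗ K → ¬ ¬ FinPres K
fp-factor-ω {K = K} p f k = fp-cuts p (≅-trans f (unroll K)) (k ∘ proj₁)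

fp-factor-ω* : ∀ {L K} → FinPres L → L ≅ ω* ⊗ K → ¬ ¬ FinPres K
fp-factor-ω* {L} {K} p f k = fp-factor-ω (fp-op p) (≅-trans (op-cong f) (op-ω*⊗ K)) (k ∘ fp≅ (op-op K) ∘ fp-op)

-- Scattered orders

infix 4 _↪_

record _↪_ (L M : LinOrd) : Set where
  constructor embedding
  field
    fun  : Carrier L → Carrier M
    mono : ∀ {x y} → lt L x y → lt M (fun x) (fun y)

open _↪_

↪-trans : ∀ {L M N} → L ↪ M → M ↪ N → L ↪ N
↪-trans f g = embedding (fun g ∘ fun f) (mono g ∘ mono f)

≅⇒↪ : ∀ {L M} → L ≅ M → L ↪ M
≅⇒↪ f = embedding (to f) (to-mono f)

inl : ∀ {A B} → A ↪ A ⊕ B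
inl = embedding inj₁ ₁<₁

inr : ∀ {A B} → B ↪ A ⊕ B
inr = embedding inj₂ ₂<₂

op-↪ : ∀ {L M} → L ↪ M → op L ↪ op M
op-↪ f = embedding (fun f) (mono f)

into-left : ∀ {X A B} (f : X ↪ A ⊕ B) → (∀ x b → ¬ fun f x ≡ inj₂ b) → X ↪ A
into-left {A = A} {B} f h = embedding (λ x → proj₁ (fromLeft (fun f x) (h x))) λ {x} {y} p →
  ₁<₁⁻¹ (subst₂ (lt (A ⊕ B)) (proj₂ (fromLeft (fun f x) (h x))) (proj₂ (fromLeft (fun f y) (h y))) (mono f p))

into-right : ∀ {X A B} (f : X ↪ A ⊕ B) → (∀ x a → ¬ fun f x ≡ inj₁ a) → X ↪ B
into-right {A = A} {B} f h = embedding (λ x → proj₁ (fromRight (fun f x) (h x))) λ {x} {y} p →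
  ₂<₂⁻¹ (subst₂ (lt (A ⊕ B)) (proj₂ (fromRight (fun f x) (h x))) (proj₂ (fromRight (fun f y) (h y))) (mono f p))

-- A nonempty X with X ⊕ X ↪ X contains a copy of the rationals, so this is scatteredness.
Scattered : LinOrd → Set₁
Scattered L = ∀ X → Carrier X → X ⊕ X ↪ X → ¬ X ↪ L

scattered-↪ : ∀ {L M} → L ↪ M → Scattered M → Scattered L
scattered-↪ f s X x d g = s X x d (↪-trans g f)

scattered-≅ : ∀ {L M} → L ≅ M → Scattered L → Scattered M
scattered-≅ f = scattered-↪ (≅⇒↪ (≅-sym f))

scattered-empty : ∀ {L} → ¬ Carrier L → Scattered L
scattered-empty e X x _ f = e (fun f x)

scattered-𝟙 : Scattered 𝟙
scattered-𝟙 X x d f = mono (↪-trans d f) {inj₁ x} {inj₂ x} ₁<₂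

-- If the left copy of `X` in `X ⊕ X` has a point sent into `B`, the whole right copy goes into `B`;
-- otherwise the left copy stays in `A`.
scattered-⊕ : ∀ {A B} → Scattered A → Scattered B → Scattered (A ⊕ B)
scattered-⊕ {A} {B} s t X x d f = ¬¬-excluded-middle {A = Meets} λ
  { (yes (y , b , e)) → t X x d (into-right (↪-trans inr g) (λ z a e' →
      ₂≮₁ (subst₂ (lt (A ⊕ B)) e e' (mono g {inj₁ y} {inj₂ z} ₁<₂))))
  ; (no ¬m) → s X x d (into-left (↪-trans inl g) (λ z b e → ¬m (z , b , e))) }
  where
  g : X ⊕ X ↪ A ⊕ B
  g = ↪-trans d f
  Meets : Set
  Meets = Σ[ y ∈ Carrier X ] Σ[ b ∈ Carrier B ] fun g (inj₁ y) ≡ inj₂ b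
  ₂≮₁ : ∀ {a b} → ¬ lt (A ⊕ B) (inj₂ b) (inj₁ a)
  ₂≮₁ ()

scattered-op : ∀ {L} → Scattered L → Scattered (op L)
scattered-op {L} s X x d f = s (op X) x (↪-trans (≅⇒↪ (≅-sym (op-⊕ X X))) (op-↪ d))
  (↪-trans (op-↪ f) (≅⇒↪ (op-op L)))

scattered-𝐅⊗ : ∀ n {L} → Scattered L → Scattered (𝐅 n ⊗ L)
scattered-𝐅⊗ zero s = scattered-empty (λ ())
scattered-𝐅⊗ (suc n) {L} s =
  scattered-≅ (≅-sym (𝐅-suc n L)) (scattered-⊕ s (scattered-𝐅⊗ n s))

-- The left copy of X in X ⊕ X is mapped below a point of the right one, hence into finitely many copies of L.
scattered-ω⊗ : ∀ {L} → Scattered L → Scattered (ω ⊗ L)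
scattered-ω⊗ {L} s X x d f = scattered-𝐅⊗ (suc n) s X x d (into-left h bounded)
  where
  g : X ⊕ X ↪ ω ⊗ L
  g = ↪-trans d f
  n = proj₁ (fun g (inj₂ x))
  h : X ↪ 𝐅 (suc n) ⊗ L ⊕ ω ⊗ L
  h = ↪-trans inl (↪-trans g (≅⇒↪ (≅-sym (multiple⊕ω⊗ (suc n) L))))
  bounded : ∀ y b → ¬ fun h y ≡ inj₂ b
  bounded y (k , m) e = ℕₚ.<⇒≱ (s≤s (ℕₚ.m≤m+n n k)) (lex-≤ (subst (λ z → lt (ω ⊗ L) z (fun g (inj₂ x)))
    (trans (sym (to∘from (multiple⊕ω⊗ (suc n) L) (fun g (inj₁ y)))) (cong (to (multiple⊕ω⊗ (suc n) L)) e))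
    (mono g {inj₁ y} ₁<₂)))

fp-scattered : ∀ {L} → FinPres L → Scattered L
fp-scattered fp𝟘 = scattered-empty id
fp-scattered fp𝟙 = scattered-𝟙
fp-scattered (fp⊕ p q) = scattered-⊕ (fp-scattered p) (fp-scattered q)
fp-scattered (fpω p) = scattered-ω⊗ (fp-scattered p)
fp-scattered (fpω* {L} p) = scattered-≅ (≅-trans (op-ω⊗ (op L)) (⊗-congˡ (op-op L)))
  (scattered-op (scattered-ω⊗ (scattered-op (fp-scattered p))))
fp-scattered (fp≅ f p) = scattered-≅ f (fp-scattered p)

-- Shifting the copies of `N` far enough down embeds `ω* ⊗ N` below a point of the first copy of `M`
-- in `ω ⊗ M`, hence into `M` itself. So `M ⊕ M` embeds into `ω ⊗ M`, thus into `M`, although `M`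
-- embeds into the scattered `L`.
ω⊗≇ω*⊗ : ∀ {L M N} → Scattered L → Carrier L → L ≅ ω ⊗ M → ¬ L ≅ ω* ⊗ N
ω⊗≇ω*⊗ {L} {M} {N} s l f g = s M m double (↪-trans first (≅⇒↪ (≅-sym f)))
  where
  m = proj₂ (to f l)
  i : ω* ⊗ N ≅ ω ⊗ M
  i = ≅-trans (≅-sym g) f
  first : M ↪ ω ⊗ M
  first = embedding (zero ,_) snd<
  two : M ⊕ M ↪ ω ⊗ M
  two = embedding (λ { (inj₁ x) → 0 , x ; (inj₂ x) → 1 , x })
    (λ { (₁<₁ p) → snd< p ; (₂<₂ p) → snd< p ; ₁<₂ → fst< (s≤s z≤n) })
  n = proj₁ (from i (zero , m))
  shift : ω* ⊗ N ↪ ω ⊗ M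
  shift = embedding (λ (q , y) → to i (suc n + q , y))
    (λ { (fst< p) → to-mono i (fst< (ℕₚ.+-monoʳ-< (suc n) p)) ; (snd< p) → to-mono i (snd< p) })
  shift≤0 : ∀ z → proj₁ (fun shift z) ≤ 0
  shift≤0 (q , y) = lex-≤ (subst (lt (ω ⊗ M) _) (to∘from i (zero , m))
    (to-mono i (fst< (s≤s (ℕₚ.m≤m+n n q)))))
  head : ∀ {x y} → lt (ω ⊗ M) x y → proj₁ y ≤ 0 → lt M (proj₂ x) (proj₂ y)
  head (fst< p) q = ⊥-elim (ℕₚ.<⇒≱ p (ℕₚ.≤-trans q z≤n))
  head (snd< p) _ = p
  into-M : ω* ⊗ N ↪ M
  into-M = embedding (proj₂ ∘ fun shift) (λ {x} {y} p → head (mono shift p) (shift≤0 y))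
  double : M ⊕ M ↪ M
  double = ↪-trans two (↪-trans (≅⇒↪ (≅-sym i)) into-M)

-- The counting argument

-- `K` may be any order, so the results of gluing qualify at once; `fp-factor-ω` and `fp-factor-ω*`
-- recover finite presentability where a tree is wanted.
data WidthOne (L : LinOrd) : Set₁ where
  one   : L ≅ 𝟙 → WidthOne L
  plus  : ∀ K → L ≅ ω ⊗ K → WidthOne L
  minus : ∀ K → L ≅ ω* ⊗ K → WidthOne L

width-one-≅ : ∀ {L M} → L ≅ M → WidthOne L → WidthOne M
width-one-≅ f (one g) = one (≅-trans (≅-sym f) g)
width-one-≅ f (plus K g) = plus K (≅-trans (≅-sym f) g)
width-one-≅ f (minus K g) = minus K (≅-trans (≅-sym f) g)

⊕≇𝟙 : ∀ {A B} → Carrier A → Carrier B → ¬ A ⊕ B ≅ 𝟙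
⊕≇𝟙 a b f = to-mono f (₁<₂ {a = a} {b})

record Block (L : LinOrd) : Set₁ where
  constructor block
  field
    shape : WidthOne L
    point : Carrier L

record ScatteredBlock (L : LinOrd) : Set₁ where
  constructor scattered-block
  field
    shape     : WidthOne L
    point     : Carrier L
    scattered : Scattered L

Unmergeable : LinOrd → LinOrd → Set₁
Unmergeable L M = ¬ WidthOne (L ⊕ M)

Σ⊕ : List LinOrd → LinOrd
Σ⊕ [] = 𝟘
Σ⊕ (L ∷ Ls) = L ⊕ Σ⊕ Ls

relink : ∀ {L M Ls} → (∀ {N} → ScatteredBlock N → Unmergeable L N → Unmergeable M N) →
         All ScatteredBlock Ls → Linked Unmergeable (L ∷ Ls) → Linked Unmergeable (M ∷ Ls)
relink h _ [-] = [-]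
relink h (n ∷ _) (u ∷ us) = h n u ∷ us

-- Allows the remainder of an ω-shaped block to stand in for the block. If `X ⊕ M` had shape ω,
-- gluing along `X` would merge `L` with `M`; if it had shape ω*, its initial segment `X` would have
-- both shapes.
unmergeable-final-ω : ∀ {L N U X M} → Scattered L → L ≅ ω ⊗ N → L ≅ U ⊕ X → Carrier X → Carrier M →
                      Unmergeable L M → Unmergeable X M
unmergeable-final-ω {L} {N} {U} {X} {M} s f g x m u = λ
  { (one h) → ⊕≇𝟙 x m h
  ; (plus K h) → let K' , e = glue-ω ω-U⊕X (≅-sym h) x m in
      u (plus K' (≅-trans (⊕-congʳ g) e))
  ; (minus K h) → ω⊗≇ω*⊗ (scattered-↪ (↪-trans inr (≅⇒↪ (≅-sym g))) s) x
      (proj₂ (final-ω ω-U⊕X x)) (proj₂ (initial-ω* (≅-sym h) x)) }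
  where
  ω-U⊕X : ω ⊗ N ≅ U ⊕ X
  ω-U⊕X = ≅-trans (≅-sym f) g

final-block-ω : ∀ {L N U X} → Scattered L → L ≅ ω ⊗ N → L ≅ U ⊕ X → Carrier X → ScatteredBlock X
final-block-ω s f g x = scattered-block
  (let K , e = final-ω (≅-trans (≅-sym f) g) x in plus K e) x
  (scattered-↪ (↪-trans inr (≅⇒↪ (≅-sym g))) s)

-- If a block of shape ω ⊗ M starts with L, then a later block reaches its end, and merges with its predecessor.
no-early-summand-ω : ∀ {L P M X} Ls {R} → Linked Unmergeable (L ∷ Ls) → All ScatteredBlock Ls →
                     P ≅ ω ⊗ M → L ⊕ X ≅ P → Carrier X → ¬ Σ⊕ Ls ≅ X ⊕ R
no-early-summand-ω [] _ _ f g x h = from h (inj₁ x)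
no-early-summand-ω {L} {P} {M} {X} (L' ∷ Ls) (u ∷ us) (scattered-block w l' s ∷ ws) f g x h =
  refine h λ
    { (aligned e _) → u (plus M (≅-trans (≅-trans (⊕-congˡ e) g) f))
    ; (longer Y y e _) → overhang w y e
    -- `X` is itself of shape ω and now starts with `L'`, so the argument repeats one block further
    -- on.
    ; (shorter Y y e h') → no-early-summand-ω Ls us ws X≅ω⊗ e y h' }
  where
  ω-L⊕X : ω ⊗ M ≅ L ⊕ X
  ω-L⊕X = ≅-trans (≅-sym f) (≅-sym g)
  X≅ω⊗ = proj₂ (final-ω ω-L⊕X x)
  overhang : WidthOne L' → ∀ {Y} → Carrier Y → L' ≅ X ⊕ Y → ⊥
  overhang (one i) y e = ⊕≇𝟙 x y (≅-trans (≅-sym e) i)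
  overhang (plus N i) y e =
    let K , j = glue-ω ω-L⊕X (≅-trans (≅-sym i) e) x y in
    u (plus K (≅-trans (⊕-congˡ e) (≅-trans (≅-sym (⊕-assoc L X _)) j)))
  overhang (minus N i) y e = ω⊗≇ω*⊗ (scattered-↪ (↪-trans inl (≅⇒↪ (≅-sym e))) s) x
    X≅ω⊗ (proj₂ (initial-ω* (≅-trans (≅-sym i) e) x))

⊕≇𝟘 : ∀ {A B} → Carrier A → ¬ A ⊕ B ≅ 𝟘
⊕≇𝟘 a f = to f (inj₁ a)

mutual
  -- Both sums are read from the left by comparing first blocks. Each block on the left is paid for
  -- by the block on the right that it chooses; blocks chosen by none are discarded, which only
  -- strengthens the inequality.
  no-shorter-sum : ∀ Ls Ps → Linked Unmergeable Ls → All ScatteredBlock Ls → All Block Ps →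
                   Σ⊕ Ls ≅ Σ⊕ Ps → ¬ length Ps < length Ls
  no-shorter-sum (L ∷ Ls) [] us (w ∷ ws) bs f _ = ⊕≇𝟘 (ScatteredBlock.point w) f
  no-shorter-sum (L ∷ Ls) (P ∷ Ps) us ws (b ∷ bs) f (s≤s n) = no-shorter-cons Ps us ws b bs f n

  -- `P` is kept outside the list so that a remainder of an earlier block can take its place while
  -- the recursion on `Ps` stays structural.
  no-shorter-cons : ∀ {L Ls P} Ps → Linked Unmergeable (L ∷ Ls) → All ScatteredBlock (L ∷ Ls) →
                    Block P → All Block Ps → L ⊕ Σ⊕ Ls ≅ P ⊕ Σ⊕ Ps → ¬ length Ps < length Ls
  no-shorter-cons {L} {L' ∷ Ls} {P} Ps (u ∷ us)
                  (scattered-block w l s ∷ scattered-block w' l' s' ∷ ws) (block v p) bs f n =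
    refine f λ
      { (aligned _ g) → no-shorter-sum (L' ∷ Ls) Ps us ws' bs g n
      ; (longer X x e g) → L-overhangs w x e g
      ; (shorter X x e g) → P-overhangs v x e g }
    where
    ws' = scattered-block w' l' s' ∷ ws

    L-overhangs : WidthOne L → ∀ {X} → Carrier X → L ≅ P ⊕ X → X ⊕ Σ⊕ (L' ∷ Ls) ≅ Σ⊕ Ps → ⊥
    L-overhangs (one i) x e g = ⊕≇𝟙 p x (≅-trans (≅-sym e) i)
    -- The end of `L` lies beyond `P`, so `P` is discarded and `X` replaces `L` in the count.
    L-overhangs (plus N i) {X} x e g = no-shorter-sum (X ∷ L' ∷ Ls) Ps
      (unmergeable-final-ω s i e x l' u ∷ us) (final-block-ω s i e x ∷ ws') bs g (ℕₚ.m<n⇒m<1+n n)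
    -- `L` begins inside `P`, so `P` pays for `L`.
    L-overhangs (minus N i) x e g = no-shorter-tail Ps (u ∷ us) ws' bs i e p x g n

    P-overhangs : WidthOne P → ∀ {X} → Carrier X → L ⊕ X ≅ P → Σ⊕ (L' ∷ Ls) ≅ X ⊕ Σ⊕ Ps → ⊥
    P-overhangs (one i) x e g = ⊕≇𝟙 l x (≅-trans e i)
    P-overhangs (plus M i) x e g = no-early-summand-ω (L' ∷ Ls) (u ∷ us) ws' i e x g
    -- `P` pays for `L`. The next block must neither end inside `P` nor have shape ω*, as it would
    -- then merge with `L`; if it has shape ω, its remainder beyond `P` replaces it.
    P-overhangs (minus M i) {X} x e g = refine g λ
      { (aligned h _) → u (minus M (≅-trans (⊕-congˡ h) (≅-sym ω*-L⊕X)))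
      ; (longer Y y h k) → L'-overhangs w' y h k
      ; (shorter Y y h _) →
          let K , j = initial-ω* (≅-trans ω*-L⊕X (≅-trans (⊕-congˡ (≅-sym h)) (≅-sym (⊕-assoc L L' Y)))) (inj₁ l)
          in u (minus K j) }
      where
      ω*-L⊕X : ω* ⊗ M ≅ L ⊕ X
      ω*-L⊕X = ≅-trans (≅-sym i) (≅-sym e)

      L'-overhangs : WidthOne L' → ∀ {Y} → Carrier Y → L' ≅ X ⊕ Y → Y ⊕ Σ⊕ Ls ≅ Σ⊕ Ps → ⊥
      L'-overhangs (one j) y h k = ⊕≇𝟙 x y (≅-trans (≅-sym h) j)
      L'-overhangs (plus N j) {Y} y h k = no-shorter-sum (Y ∷ Ls) Ps
        (relink (unmergeable-final-ω s' j h y ∘ ScatteredBlock.point) ws us)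
        (final-block-ω s' j h y ∷ ws) bs k n
      L'-overhangs (minus N j) {Y} y h k =
        let K , e' = glue-ω* ω*-L⊕X (≅-trans (≅-sym j) h) l x
        in u (minus K (≅-trans (⊕-congˡ h) (≅-trans (≅-sym (⊕-assoc L X Y)) e')))

  -- L has shape ω* ⊗ N and its choice is already made inside U, so the remainder X need not be counted.
  no-shorter-tail : ∀ {L N U X Ls} Ps → Linked Unmergeable (L ∷ Ls) → All ScatteredBlock Ls → All Block Ps →
                    L ≅ ω* ⊗ N → L ≅ U ⊕ X → Carrier U → Carrier X →
                    X ⊕ Σ⊕ Ls ≅ Σ⊕ Ps → ¬ length Ps < length Ls
  no-shorter-tail [] us ws bs i e u₀ x f n = ⊕≇𝟘 x f
  no-shorter-tail {L} {N} {U} {X} {L' ∷ Ls} (P ∷ Ps) (u ∷ us)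
                  (scattered-block w l' s ∷ ws) (block v p ∷ bs) i e u₀ x f (s≤s n) =
    refine f λ
      { (aligned _ g) → no-shorter-sum (L' ∷ Ls) Ps us ws' bs g (ℕₚ.m<n⇒m<1+n n)
      ; (longer Y y h g) → no-shorter-tail Ps (u ∷ us) ws' bs i
          (≅-trans e (≅-trans (⊕-congˡ h) (≅-sym (⊕-assoc U P Y)))) (inj₁ u₀) y g (ℕₚ.m<n⇒m<1+n n)
      ; (shorter Y y h g) → P-overhangs v y h g }
    where
    ws' = scattered-block w l' s ∷ ws

    -- The ω*-shaped orders `U ⊕ X` and `X ⊕ L'` overlap in `X`, so gluing them merges `L` with
    -- `L'`.
    merge : ∀ {K} → X ⊕ L' ≅ ω* ⊗ K → ⊥
    merge h =
      let K , j = glue-ω* (≅-trans (≅-sym i) e) (≅-sym h) u₀ x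
      in u (minus K (≅-trans (⊕-congʳ e) j))

    P-overhangs : WidthOne P → ∀ {Y} → Carrier Y → X ⊕ Y ≅ P → Σ⊕ (L' ∷ Ls) ≅ Y ⊕ Σ⊕ Ps → ⊥
    P-overhangs (one j) y h g = ⊕≇𝟙 x y (≅-trans h j)
    -- Only the start of `P` is taken up by `X`, which is already paid for; the remainder `Y` keeps
    -- shape ω and can still be chosen, so it serves as the new first block.
    P-overhangs (plus M j) y h g =
      let K , k = final-ω (≅-trans (≅-sym j) (≅-sym h)) y
      in no-shorter-cons Ps us ws' (block (plus K k) y) bs g n
    P-overhangs (minus M j) {Y} y h g = refine g λ
      { (aligned k _) → merge (≅-trans (⊕-congˡ k) (≅-trans h j))
      ; (longer Z z k g') → L'-overhangs w z k g'
      ; (shorter Z z k _) → merge (proj₂ (initial-ω*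
          (≅-trans (≅-sym j) (≅-trans (≅-sym h) (≅-trans (⊕-congˡ (≅-sym k)) (≅-sym (⊕-assoc X L' Z))))) (inj₁ x))) }
      where
      L'-overhangs : WidthOne L' → ∀ {Z} → Carrier Z → L' ≅ Y ⊕ Z → Z ⊕ Σ⊕ Ls ≅ Σ⊕ Ps → ⊥
      L'-overhangs (one k) z q g' = ⊕≇𝟙 y z (≅-trans (≅-sym q) k)
      L'-overhangs (plus M k) {Z} z q g' = no-shorter-sum (Z ∷ Ls) Ps
        (relink (unmergeable-final-ω s k q z ∘ ScatteredBlock.point) ws us)
        (final-block-ω s k q z ∷ ws) bs g' (ℕₚ.m<n⇒m<1+n n)
      -- `L'` begins inside `P`, so `P` pays for `L'` and the uncounted remainder is now `Z`.
      L'-overhangs (minus M k) z q g' = no-shorter-tail Ps us ws bs k q y z g' n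

-- Signed trees

Σ⊕-++ : ∀ xs ys → Σ⊕ (map linAt (xs ++ ys)) ≅ Σ⊕ (map linAt xs) ⊕ Σ⊕ (map linAt ys)
Σ⊕-++ [] ys = ≅-sym (⊕-emptyˡ id)
Σ⊕-++ (x ∷ xs) ys = ≅-trans (⊕-congˡ (Σ⊕-++ xs ys)) (≅-sym (⊕-assoc (linAt x) _ _))

linSum≅Σ⊕ : ∀ c cs → linSum c cs ≅ Σ⊕ (map linAt (c ∷ cs))
linSum≅Σ⊕ c [] = ≅-sym (⊕-emptyʳ id)
linSum≅Σ⊕ c (d ∷ ds) = ⊕-congˡ (linSum≅Σ⊕ d ds)

LIN≅Σ⊕ : ∀ cs → LIN (node nul cs) ≅ Σ⊕ (map linAt cs)
LIN≅Σ⊕ [] = ≅-refl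
LIN≅Σ⊕ (c ∷ cs) = ≅-trans (𝟙⊗ (linSum c cs)) (linSum≅Σ⊕ c cs)

mutual
  linAt-point : ∀ {c} → NonRootOK c → Carrier (linAt c)
  linAt-point leaf = tt , tt
  linAt-point (inner (inj₁ refl) (o ∷ os)) = zero , linSum-point o os
  linAt-point (inner (inj₂ refl) (o ∷ os)) = zero , linSum-point o os

  linSum-point : ∀ {c cs} → NonRootOK c → All NonRootOK cs → Carrier (linSum c cs)
  linSum-point o [] = linAt-point o
  linSum-point o (_ ∷ _) = inj₁ (linAt-point o)

linAt-block : ∀ {c} → NonRootOK c → Block (linAt c)
linAt-block o = block (shape o) (linAt-point o)
  where
  shape : ∀ {c} → NonRootOK c → WidthOne (linAt c)
  shape leaf = one (𝟙⊗ 𝟙)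
  shape (inner (inj₁ refl) _) = plus _ ≅-refl
  shape (inner (inj₂ refl) _) = minus _ ≅-refl

linAt-blocks : ∀ {cs} → All NonRootOK cs → All Block (map linAt cs)
linAt-blocks [] = []
linAt-blocks (o ∷ os) = linAt-block o ∷ linAt-blocks os

-- The root is left off so that the same list can be placed below a signed node.
record Forest (L : LinOrd) : Set where
  constructor forest
  field
    trees : List SignedTree
    valid : All NonRootOK trees
    sum≅  : Σ⊕ (map linAt trees) ≅ L

forest-signed : ∀ s {A L} → s ≡ plus ⊎ s ≡ minus → ωPow s ≅ A → Forest L → Forest (A ⊗ L)
-- A childless node would denote a nonempty order, so the empty order keeps the empty forest.
forest-signed s _ i (forest [] _ f) =
  forest [] [] (≅-sym (empty≅𝟘 (from f ∘ proj₂)))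
forest-signed s o i (forest (c ∷ cs) v f) = forest (node s (c ∷ cs) ∷ []) (inner o v ∷ [])
  (≅-trans (⊕-emptyʳ id) (⊗-cong i (≅-trans (linSum≅Σ⊕ c cs) f)))

fp-forest : ∀ {L} → FinPres L → Forest L
fp-forest fp𝟘 = forest [] [] ≅-refl
fp-forest fp𝟙 = forest (node nul [] ∷ []) (leaf ∷ []) (≅-trans (⊕-emptyʳ id) (𝟙⊗ 𝟙))
fp-forest (fp⊕ p q) =
  let forest xs v f = fp-forest p
      forest ys w g = fp-forest q
  in forest (xs ++ ys) (++⁺ v w) (≅-trans (Σ⊕-++ xs ys) (⊕-cong f g))
fp-forest (fpω p) = forest-signed plus (inj₁ refl) ≅-refl (fp-forest p)
fp-forest (fpω* p) = forest-signed minus (inj₂ refl) ≅-refl (fp-forest p)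
fp-forest (fp≅ i p) = let forest cs v f = fp-forest p in forest cs v (≅-trans f i)

-- A forest for `K` below a single node of sign `s` would give a tree for `L` of root width one.
wide⇒not-signed : ∀ s {L K k} → s ≡ plus ⊎ s ≡ minus → HasWidth L (suc (suc k)) → Carrier L →
                  FinPres K → ¬ L ≅ ωPow s ⊗ K
wide⇒not-signed s o h l p f with fp-forest p
... | forest [] _ g = from g (proj₂ (to f l))
... | forest (c ∷ cs) v g with proj₂ h (node nul (node s (c ∷ cs) ∷ [])) (refl , inner o v ∷ [])
        (≅-trans (𝟙⊗ _) (≅-trans (⊗-congˡ (≅-trans (linSum≅Σ⊕ c cs) g)) (≅-sym f)))
...   | s≤s ()

wide⇒unmergeable : ∀ {L M} → FinPres L → FinPres M → Carrier L → Carrier M →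
                   HasWidth (L ⊕ M) 2 → Unmergeable L M
wide⇒unmergeable p q l m h (one f) = ⊕≇𝟙 l m f
wide⇒unmergeable p q l m h (plus K f) = fp-factor-ω (fp⊕ p q) f λ k →
  wide⇒not-signed plus (inj₁ refl) h (inj₁ l) k f
wide⇒unmergeable p q l m h (minus K f) = fp-factor-ω* (fp⊕ p q) f λ k →
  wide⇒not-signed minus (inj₂ refl) h (inj₁ l) k f

root-child : ∀ {L} → HasWidth L 1 → Σ[ c ∈ SignedTree ] NonRootOK c × linAt c ≅ L
root-child ((node nul (c ∷ []) , (refl , o ∷ []) , f , refl) , _) =
  c , o , ≅-trans (≅-sym (𝟙⊗ (linAt c))) f

linked-tabulate : ∀ n (L : Fin n → LinOrd) →
                  (∀ (i j : Fin n) → toℕ j ≡ suc (toℕ i) → Unmergeable (L i) (L j)) →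
                  Linked Unmergeable (tabulate L)
linked-tabulate zero L u = []
linked-tabulate (suc zero) L u = [-]
linked-tabulate (suc (suc n)) L u =
  u zero (suc zero) refl ∷ linked-tabulate (suc n) (L ∘ suc) (λ i j e → u (suc i) (suc j) (cong suc e))

⨁≅Σ⊕ : ∀ n (L : Fin n → LinOrd) → ⨁ n L ≅ Σ⊕ (tabulate L)
⨁≅Σ⊕ zero L = ≅-refl
⨁≅Σ⊕ (suc n) L = ⊕-congˡ (⨁≅Σ⊕ n (L ∘ suc))

Σ⊕-tabulate≅⨁ : ∀ n (c : Fin n → SignedTree) (L : Fin n → LinOrd) → (∀ i → linAt (c i) ≅ L i) →
                Σ⊕ (map linAt (tabulate c)) ≅ ⨁ n L
Σ⊕-tabulate≅⨁ zero c L f = ≅-refl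
Σ⊕-tabulate≅⨁ (suc n) c L f = ⊕-cong (f zero) (Σ⊕-tabulate≅⨁ n (c ∘ suc) (L ∘ suc) (f ∘ suc))

theorem8p6 : (n : ℕ) → 1 < n → (L : Fin n → LinOrd) →
    (∀ i → FinPres (L i)) →
    (∀ i → HasWidth (L i) 1) →
    (∀ (i j : Fin n) → toℕ j ≡ suc (toℕ i) → HasWidth (L i ⊕ L j) 2) →
    HasWidth (⨁ n L) n
theorem8p6 n _ L p h₁ h₂ =
  -- The upper bound puts the only root child of a width-one tree for each `L i` under a common
  -- root.
  (node nul (tabulate child) , (refl , tabulate⁺ child-ok)
    , ≅-trans (LIN≅Σ⊕ (tabulate child)) (Σ⊕-tabulate≅⨁ n child L linAt-child)
    , length-tabulate child) , minimal
  where
  child : Fin n → SignedTree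
  child i = proj₁ (root-child (h₁ i))
  child-ok : ∀ i → NonRootOK (child i)
  child-ok i = proj₁ (proj₂ (root-child (h₁ i)))
  linAt-child : ∀ i → linAt (child i) ≅ L i
  linAt-child i = proj₂ (proj₂ (root-child (h₁ i)))
  point : ∀ i → Carrier (L i)
  point i = to (linAt-child i) (linAt-point (child-ok i))
  block-L : ∀ i → ScatteredBlock (L i)
  block-L i = scattered-block
    (width-one-≅ (linAt-child i) (Block.shape (linAt-block (child-ok i)))) (point i) (fp-scattered (p i))
  unmergeable : ∀ i j → toℕ j ≡ suc (toℕ i) → Unmergeable (L i) (L j)
  unmergeable i j e = wide⇒unmergeable (p i) (p j) (point i) (point j) (h₂ i j e)
  minimal : ∀ T → Is3ST T → LIN T ≅ ⨁ n L → n ≤ rootWidth T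
  minimal (node nul cs) (refl , os) f = decidable-stable (n ≤? length cs) λ n≰ →
    no-shorter-sum (tabulate L) (map linAt cs) (linked-tabulate n L unmergeable) (tabulate⁺ block-L)
      (linAt-blocks os)
      (≅-trans (≅-sym (⨁≅Σ⊕ n L)) (≅-trans (≅-sym f) (LIN≅Σ⊕ cs)))
      (subst₂ _<_ (sym (length-map linAt cs)) (sym (length-tabulate L)) (ℕₚ.≰⇒> n≰))
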